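{- Let $N$ be an $m\times n$ matrix with $m,n\ge 3$ that is a representation matrix of a $3$-connected regular matroid. If $N$ contains, up to row and column permutations and scaling of rows and columns by $-1$, the submatrix $\begin{bmatrix}1&1\\1&1\end{bmatrix}$, then $N$ is not strongly unimodular.
   Context: A matrix $N$ represents the matroid $M$ if $M$ is the (real) vector matroid of $[I\mid N]$. A real matrix is totally unimodular (TU) if every square submatrix has determinant $0,+1,-1$; it is strongly unimodular (SU) if it is TU and every matrix obtained by setting a single $\pm1$ entry to $0$ is also TU.
   Formalization: The matrix N, and linear independence in the vector matroid of [I|N], are taken over the rational numbers instead of the reals; a real strongly unimodular matrix has entries 0, ±1 anyway. -}

module Defs where

open import Data.Nat using (ℕ; zero; suc; _≤_; _<_) renaming (_+_ to _+ℕ_)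
open import Data.Fin using (Fin; zero; suc; splitAt; punchIn; _≟_)
open import Data.Fin.Subset using (Subset; _∈_; _∉_; _⊆_; ∁; ⊤; ∣_∣)
open import Data.Rational using (ℚ; 0ℚ; 1ℚ; _+_; _*_; -_)
open import Data.Sum using (_⊎_; inj₁; inj₂)
open import Data.Product using (Σ; _×_; ∃; _,_)
open import Relation.Binary.PropositionalEquality using (_≡_)
open import Relation.Nullary using (¬_; yes; no)
open import Function.Definitions using (Injective)
open import Function.Bundles using (_⇔_)

-- Real matrices are represented by rational matrices.
Matrix : ℕ → ℕ → Set
Matrix m n = Fin m → Fin n → ℚ

sumFin : ∀ {k} → (Fin k → ℚ) → ℚ
sumFin {zero}  f = 0ℚ
sumFin {suc k} f = f zero + sumFin (λ i → f (suc i))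

altSign : ℕ → ℚ
altSign zero    = 1ℚ
altSign (suc n) = - altSign n

toℕ' : ∀ {k} → Fin k → ℕ
toℕ' zero    = zero
toℕ' (suc i) = suc (toℕ' i)

det : ∀ {k} → Matrix k k → ℚ
det {zero}  A = 1ℚ
det {suc k} A =
  sumFin (λ j → altSign (toℕ' j) * (A zero j * det (λ i j' → A (suc i) (punchIn j j'))))

TU : ∀ {m n} → Matrix m n → Set
TU {m} {n} N =
  ∀ (k : ℕ) (f : Fin k → Fin m) (g : Fin k → Fin n) →
  Injective _≡_ _≡_ f → Injective _≡_ _≡_ g →
  let d = det (λ i j → N (f i) (g j)) in
  (d ≡ 0ℚ) ⊎ (d ≡ 1ℚ) ⊎ (d ≡ - 1ℚ)

zeroEntry : ∀ {m n} → Matrix m n → Fin m → Fin n → Matrix m n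
zeroEntry N i j i' j' with i ≟ i' | j ≟ j'
... | yes _ | yes _ = 0ℚ
... | _     | _     = N i' j'

SU : ∀ {m n} → Matrix m n → Set
SU N = TU N × (∀ i j → (N i j ≡ 1ℚ) ⊎ (N i j ≡ - 1ℚ) → TU (zeroEntry N i j))

-- Matroids on ground set Fin E, given by their independence predicate.
Matroid : ℕ → Set₁
Matroid E = Subset E → Set

vecMatroid : ∀ {r E} → Matrix r E → Matroid E
vecMatroid {r} {E} A S =
  ∀ (c : Fin E → ℚ) → (∀ e → e ∉ S → c e ≡ 0ℚ) →
  (∀ i → sumFin (λ e → c e * A i e) ≡ 0ℚ) → ∀ e → c e ≡ 0ℚ

IN : ∀ {m n} → Matrix m n → Matrix m (m +ℕ n)
IN {m} N i e with splitAt m e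
... | inj₁ i' with i ≟ i'
...   | yes _ = 1ℚ
...   | no  _ = 0ℚ
IN {m} N i e | inj₂ j = N i j

matroidOf : ∀ {m n} → Matrix m n → Matroid (m +ℕ n)
matroidOf N = vecMatroid (IN N)

Regular : ∀ {E} → Matroid E → Set
Regular {E} M = Σ ℕ λ r → Σ (Matrix r E) λ A → TU A × (∀ S → M S ⇔ vecMatroid A S)

HasRank : ∀ {E} → Matroid E → Subset E → ℕ → Set
HasRank M X t =
  (∃ λ I → I ⊆ X × M I × ∣ I ∣ ≡ t) × (∀ I → I ⊆ X → M I → ∣ I ∣ ≤ t)

-- Tutte k-separation (X, E - X): |X|,|E-X| ≥ k and r(X) + r(E-X) - r(M) ≤ k - 1.
Separation : ∀ {E} → Matroid E → ℕ → Set
Separation M k =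
  ∃ λ X → ∃ λ a → ∃ λ b → ∃ λ c →
    HasRank M X a × HasRank M (∁ X) b × HasRank M ⊤ c ×
    k ≤ ∣ X ∣ × k ≤ ∣ ∁ X ∣ × (a +ℕ b) < (k +ℕ c)

ThreeConnected : ∀ {E} → Matroid E → Set
ThreeConnected M = ∀ k → 1 ≤ k → k < 3 → ¬ Separation M k

IsSign : ℚ → Set
IsSign s = (s ≡ 1ℚ) ⊎ (s ≡ - 1ℚ)

ContainsAllOnes2 : ∀ {m n} → Matrix m n → Set
ContainsAllOnes2 {m} {n} N =
  Σ (Fin m) λ i₁ → Σ (Fin m) λ i₂ → Σ (Fin n) λ j₁ → Σ (Fin n) λ j₂ →
  ¬ (i₁ ≡ i₂) × ¬ (j₁ ≡ j₂) ×
  Σ ℚ λ r₁ → Σ ℚ λ r₂ → Σ ℚ λ c₁ → Σ ℚ λ c₂ →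
  IsSign r₁ × IsSign r₂ × IsSign c₁ × IsSign c₂ ×
  (r₁ * N i₁ j₁ * c₁ ≡ 1ℚ) × (r₁ * N i₁ j₂ * c₂ ≡ 1ℚ) ×
  (r₂ * N i₂ j₁ * c₁ ≡ 1ℚ) × (r₂ * N i₂ j₂ * c₂ ≡ 1ℚ)

{-# OPTIONS --safe #-}
module Submission where

-- Close the given 2×2 block to a maximal all-nonzero block R × C; total
-- unimodularity makes it rank one. In the bipartite graph of the entries
-- outside R × C, either no path joins R to C, and then the vertices reachable
-- from C give a 2-separation; or a shortest such path f₀ g₀ f₁ g₁ … fₜ gₜ
-- exists, and it is chordless apart from the block entry (f₀ , gₜ). By
-- maximality some r ∈ R has N r g₀ = 0 and some c ∈ C has N fₜ c = 0.
-- The determinant of the submatrix (f ; g) is p + q with p, q = ±1, and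
-- setting the entry (f₀ , gₜ) to 0 turns that of (r , f ; c , g) into ±(p - q).
-- Both cannot lie in {0, 1, -1}.

open import Defs
open import Data.Nat as ℕ using (ℕ; zero; suc; _∸_; _≤_; _<_; _≥_; z≤n; s≤s)
import Data.Nat.Properties as ℕ
open import Data.Fin as Fin using (Fin; zero; suc; toℕ; fromℕ; inject₁; punchIn; _↑ˡ_; _↑ʳ_; splitAt)
import Data.Fin.Properties as Fin
open import Data.Fin.Subset using (Subset; inside; outside; _∈_; _∉_; _⊆_; _∪_; _-_; ∁; ⊤; ⊥; ⁅_⁆; ∣_∣)
open import Data.Fin.Subset.Properties as Subset using (_∈?_)
open import Data.Vec using ([]; _∷_; _++_; here; there; tabulate)
open import Data.Vec.Properties using (lookup⇒[]=; []=⇒lookup; lookup-++ˡ; lookup-++ʳ; lookup∘tabulate)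
open import Data.Rational using (ℚ; 0ℚ; 1ℚ; _+_; _*_; -_; 1/_; ≢-nonZero)
open import Data.Rational.Properties as ℚ using (_≟_)
open import Data.Rational.Solver using (module +-*-Solver)
open import Data.Sum using (_⊎_; inj₁; inj₂)
open import Data.Product using (Σ; _×_; ∃; _,_; proj₁; proj₂)
open import Function using (_∘_)
open import Function.Definitions using (Injective)
open import Relation.Binary.PropositionalEquality using (_≡_; _≢_; refl; sym; trans; cong; cong₂; subst; module ≡-Reasoning)
open import Relation.Nullary using (¬_; Dec; yes; no; does; contradiction; ¬?; _×-dec_; _⊎-dec_; _→-dec_)
open import Relation.Nullary.Decidable using (dec-true; decidable-stable)
open ≡-Reasoning
open +-*-Solver using (solve; _:=_; _:+_; _:*_; :-_)

-- Rational arithmetic, signs and finite sums.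

p*q≢0 : ∀ {p q} → p ≢ 0ℚ → q ≢ 0ℚ → p * q ≢ 0ℚ
p*q≢0 {p} {q} p≢0 q≢0 pq≡0 = q≢0 (begin
  q              ≡⟨ ℚ.*-identityˡ q ⟨
  1ℚ * q         ≡⟨ cong (_* q) (ℚ.*-inverseˡ p) ⟨
  1/ p * p * q   ≡⟨ ℚ.*-assoc (1/ p) p q ⟩
  1/ p * (p * q) ≡⟨ cong (1/ p *_) pq≡0 ⟩
  1/ p * 0ℚ      ≡⟨ ℚ.*-zeroʳ (1/ p) ⟩
  0ℚ             ∎)
  where instance _ = ≢-nonZero p≢0

*-zeroˡ′ : ∀ {p} q → p ≡ 0ℚ → p * q ≡ 0ℚ
*-zeroˡ′ q refl = ℚ.*-zeroˡ q

*-zeroʳ′ : ∀ p {q} → q ≡ 0ℚ → p * q ≡ 0ℚ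
*-zeroʳ′ p refl = ℚ.*-zeroʳ p

sign-* : ∀ {p q} → IsSign p → IsSign q → IsSign (p * q)
sign-* (inj₁ refl) (inj₁ refl) = inj₁ refl
sign-* (inj₁ refl) (inj₂ refl) = inj₂ refl
sign-* (inj₂ refl) (inj₁ refl) = inj₂ refl
sign-* (inj₂ refl) (inj₂ refl) = inj₁ refl

altSign-sign : ∀ k → IsSign (altSign k)
altSign-sign zero    = inj₁ refl
altSign-sign (suc k) with altSign k | altSign-sign k
... | _ | inj₁ refl = inj₂ refl
... | _ | inj₂ refl = inj₁ refl

sign-square : ∀ {p} → IsSign p → p * p ≡ 1ℚ
sign-square (inj₁ refl) = refl
sign-square (inj₂ refl) = refl

sum-cong : ∀ {k} {f g : Fin k → ℚ} → (∀ i → f i ≡ g i) → sumFin f ≡ sumFin g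
sum-cong {zero}  f≡g = refl
sum-cong {suc k} f≡g = cong₂ _+_ (f≡g zero) (sum-cong (f≡g ∘ suc))

sum-zero : ∀ {k} {f : Fin k → ℚ} → (∀ i → f i ≡ 0ℚ) → sumFin f ≡ 0ℚ
sum-zero {zero}  f≡0 = refl
sum-zero {suc k} f≡0 = cong₂ _+_ (f≡0 zero) (sum-zero (f≡0 ∘ suc))

sum-+ : ∀ {k} (f g : Fin k → ℚ) → sumFin (λ i → f i + g i) ≡ sumFin f + sumFin g
sum-+ {zero}  f g = refl
sum-+ {suc k} f g = begin
  f zero + g zero + sumFin (λ i → f (suc i) + g (suc i))
    ≡⟨ cong (f zero + g zero +_) (sum-+ (f ∘ suc) (g ∘ suc)) ⟩
  f zero + g zero + (sumFin (f ∘ suc) + sumFin (g ∘ suc))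
    ≡⟨ solve 4 (λ a b c d → a :+ b :+ (c :+ d) := a :+ c :+ (b :+ d)) refl (f zero) (g zero) _ _ ⟩
  f zero + sumFin (f ∘ suc) + (g zero + sumFin (g ∘ suc)) ∎

sum-*ʳ : ∀ {k} (f : Fin k → ℚ) a → sumFin (λ i → f i * a) ≡ sumFin f * a
sum-*ʳ {zero}  f a = sym (ℚ.*-zeroˡ a)
sum-*ʳ {suc k} f a = begin
  f zero * a + sumFin (λ i → f (suc i) * a) ≡⟨ cong (f zero * a +_) (sum-*ʳ (f ∘ suc) a) ⟩
  f zero * a + sumFin (f ∘ suc) * a         ≡⟨ ℚ.*-distribʳ-+ a (f zero) _ ⟨
  (f zero + sumFin (f ∘ suc)) * a           ∎

sum-single : ∀ {k} (f : Fin k → ℚ) p → (∀ i → i ≢ p → f i ≡ 0ℚ) → sumFin f ≡ f p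
sum-single f zero    f≡0 =
  trans (cong (f zero +_) (sum-zero (λ i → f≡0 (suc i) λ ()))) (ℚ.+-identityʳ (f zero))
sum-single f (suc p) f≡0 =
  trans (cong₂ _+_ (f≡0 zero λ ()) (sum-single (f ∘ suc) p (λ i i≢p → f≡0 (suc i) (i≢p ∘ Fin.suc-injective))))
        (ℚ.+-identityˡ (f (suc p)))

sum-splitAt : ∀ m {n} (f : Fin (m ℕ.+ n) → ℚ) →
  sumFin f ≡ sumFin (λ i → f (i ↑ˡ n)) + sumFin (λ j → f (m ↑ʳ j))
sum-splitAt zero    f = sym (ℚ.+-identityˡ (sumFin f))
sum-splitAt (suc m) f =
  trans (cong (f zero +_) (sum-splitAt m (f ∘ suc))) (sym (ℚ.+-assoc (f zero) _ _))

-- Determinants with sparse rows or columns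

minor : ∀ {k} → Matrix (suc k) (suc k) → Fin (suc k) → Matrix k k
minor A j i j' = A (suc i) (punchIn j j')

laplaceTerm : ∀ {k} → Matrix (suc k) (suc k) → Fin (suc k) → ℚ
laplaceTerm A j = altSign (toℕ' j) * (A zero j * det (minor A j))

laplaceTerm-entry≡0 : ∀ {k} (A : Matrix (suc k) (suc k)) j → A zero j ≡ 0ℚ → laplaceTerm A j ≡ 0ℚ
laplaceTerm-entry≡0 A j ≡0 = *-zeroʳ′ (altSign (toℕ' j)) (*-zeroˡ′ (det (minor A j)) ≡0)

laplaceTerm-minor≡0 : ∀ {k} (A : Matrix (suc k) (suc k)) j → det (minor A j) ≡ 0ℚ → laplaceTerm A j ≡ 0ℚ
laplaceTerm-minor≡0 A j ≡0 = *-zeroʳ′ (altSign (toℕ' j)) (*-zeroʳ′ (A zero j) ≡0)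

det-cong : ∀ {k} {A B : Matrix k k} → (∀ i j → A i j ≡ B i j) → det A ≡ det B
det-cong {zero}  A≡B = refl
det-cong {suc k} A≡B = sum-cong λ j →
  cong (altSign (toℕ' j) *_) (cong₂ _*_ (A≡B zero j) (det-cong λ i j' → A≡B (suc i) (punchIn j j')))

det-firstRow : ∀ {k} (A : Matrix (suc k) (suc k)) → (∀ j → A zero (suc j) ≡ 0ℚ) →
  det A ≡ A zero zero * det (minor A zero)
det-firstRow A row≡0 = begin
  det A ≡⟨ sum-single (laplaceTerm A) zero
            (λ { zero 0≢0 → contradiction refl 0≢0
               ; (suc j) _ → laplaceTerm-entry≡0 A (suc j) (row≡0 j) }) ⟩
  1ℚ * (A zero zero * det (minor A zero)) ≡⟨ ℚ.*-identityˡ (A zero zero * det (minor A zero)) ⟩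
  A zero zero * det (minor A zero) ∎

toℕ'≗toℕ : ∀ {k} (i : Fin k) → toℕ' i ≡ toℕ i
toℕ'≗toℕ zero    = refl
toℕ'≗toℕ (suc i) = cong suc (toℕ'≗toℕ i)

punchIn-fromℕ : ∀ {k} (j : Fin k) → punchIn (fromℕ k) j ≡ inject₁ j
punchIn-fromℕ zero    = refl
punchIn-fromℕ (suc j) = cong suc (punchIn-fromℕ j)

-- Only the first and last terms of the Laplace expansion can survive, and the last index is
-- `suc k`, whence its sign. Both large determinants of the argument have this shape.
det-firstRow₂ : ∀ {k} (A : Matrix (2 ℕ.+ k) (2 ℕ.+ k)) →
  (∀ j → suc j ≢ fromℕ (suc k) → A zero (suc j) ≡ 0ℚ) →
  det A ≡ A zero zero * det (minor A zero)
        + altSign (suc k) * (A zero (fromℕ (suc k)) * det (λ i j → A (suc i) (inject₁ j)))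
det-firstRow₂ {k} A row≡0 = cong₂ _+_ (ℚ.*-identityˡ (A zero zero * det (minor A zero))) (begin
  sumFin (laplaceTerm A ∘ suc)
    ≡⟨ sum-single (laplaceTerm A ∘ suc) (fromℕ k)
         (λ j j≢k → laplaceTerm-entry≡0 A (suc j) (row≡0 j (j≢k ∘ Fin.suc-injective))) ⟩
  laplaceTerm A (fromℕ (suc k))
    ≡⟨ cong₂ (λ l d → altSign (suc l) * (A zero (fromℕ (suc k)) * d))
         (trans (toℕ'≗toℕ (fromℕ k)) (Fin.toℕ-fromℕ k))
         (det-cong λ i j → cong (A (suc i)) (punchIn-fromℕ j)) ⟩
  altSign (suc k) * (A zero (fromℕ (suc k)) * det (λ i j → A (suc i) (inject₁ j))) ∎)

-- `det` expands along the first row. The term at `zero` has a zero entry; at any later column the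
-- minor keeps the zero column in first place, so induction applies.
det-zeroColumn : ∀ {k} (A : Matrix (suc k) (suc k)) → (∀ i → A i zero ≡ 0ℚ) → det A ≡ 0ℚ
det-zeroColumn {k} A col≡0 = sum-zero (term k A col≡0)
  where
  -- The size is an argument, so that matching on it gives the minor a first column.
  term : ∀ k (A : Matrix (suc k) (suc k)) → (∀ i → A i zero ≡ 0ℚ) → ∀ j →
    laplaceTerm A j ≡ 0ℚ
  term k       A col≡0 zero    = laplaceTerm-entry≡0 A zero (col≡0 zero)
  term (suc k) A col≡0 (suc j) =
    laplaceTerm-minor≡0 A (suc j) (det-zeroColumn (minor A (suc j)) (col≡0 ∘ suc))

-- Every minor at a column other than the first begins with a zero column, so only the first Laplace
-- term remains.
det-firstColumn : ∀ {k} (A : Matrix (suc k) (suc k)) → (∀ i → A (suc i) zero ≡ 0ℚ) →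
  det A ≡ A zero zero * det (minor A zero)
det-firstColumn {k} A col≡0 = begin
  det A ≡⟨ sum-single (laplaceTerm A) zero (term k A col≡0) ⟩
  1ℚ * (A zero zero * det (minor A zero)) ≡⟨ ℚ.*-identityˡ (A zero zero * det (minor A zero)) ⟩
  A zero zero * det (minor A zero) ∎
  where
  term : ∀ k (A : Matrix (suc k) (suc k)) → (∀ i → A (suc i) zero ≡ 0ℚ) → ∀ j → j ≢ zero →
    laplaceTerm A j ≡ 0ℚ
  term k       A col≡0 zero    0≢0 = contradiction refl 0≢0
  term (suc k) A col≡0 (suc j) _   =
    laplaceTerm-minor≡0 A (suc j) (det-zeroColumn (minor A (suc j)) col≡0)

det-lowerTriangular : ∀ {k} (A : Matrix k k) → (∀ i j → toℕ i < toℕ j → A i j ≡ 0ℚ) →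
  (∀ i → IsSign (A i i)) → IsSign (det A)
det-lowerTriangular {zero}  A above≡0 diag = inj₁ refl
det-lowerTriangular {suc k} A above≡0 diag =
  subst IsSign (sym (det-firstRow A (λ j → above≡0 zero (suc j) (s≤s z≤n))))
    (sign-* (diag zero) (det-lowerTriangular (minor A zero)
      (λ i j i<j → above≡0 (suc i) (suc j) (s≤s i<j)) (diag ∘ suc)))

det-upperTriangular : ∀ {k} (A : Matrix k k) → (∀ i j → toℕ j < toℕ i → A i j ≡ 0ℚ) →
  (∀ i → IsSign (A i i)) → IsSign (det A)
det-upperTriangular {zero}  A below≡0 diag = inj₁ refl
det-upperTriangular {suc k} A below≡0 diag =
  subst IsSign (sym (det-firstColumn A (λ i → below≡0 (suc i) zero (s≤s z≤n))))
    (sign-* (diag zero) (det-upperTriangular (minor A zero)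
      (λ i j j<i → below≡0 (suc i) (suc j) (s≤s j<i)) (diag ∘ suc)))

-- More columns than rows are dependent

sum-support : ∀ {E} (I : Subset E) (c h : Fin E → ℚ) → (∀ e → e ∉ I → c e ≡ 0ℚ) →
  (∀ e → e ∈ I → h e ≡ 0ℚ) → sumFin (λ e → c e * h e) ≡ 0ℚ
sum-support I c h c≡0 h≡0 = sum-zero λ e → term e (e ∈? I)
  where
  term : ∀ e → Dec (e ∈ I) → c e * h e ≡ 0ℚ
  term e (yes e∈I) = *-zeroʳ′ (c e) (h≡0 e e∈I)
  term e (no e∉I)  = *-zeroˡ′ (h e) (c≡0 e e∉I)

-- The Kronecker delta, defined by the same comparison as the identity part of `IN`.
δ : ∀ {k} → Fin k → Fin k → ℚ
δ i j with i Fin.≟ j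
... | yes _ = 1ℚ
... | no  _ = 0ℚ

δ-refl : ∀ {k} (i : Fin k) → δ i i ≡ 1ℚ
δ-refl i with i Fin.≟ i
... | yes _  = refl
... | no i≢i = contradiction refl i≢i

δ-≢ : ∀ {k} {i j : Fin k} → i ≢ j → δ i j ≡ 0ℚ
δ-≢ {i = i} {j} i≢j with i Fin.≟ j
... | yes i≡j = contradiction i≡j i≢j
... | no _    = refl

x∉p-x : ∀ {k} (p : Subset k) x → x ∉ (p - x)
x∉p-x (inside  ∷ p) zero    ()
x∉p-x (outside ∷ p) zero    ()
x∉p-x (_ ∷ p)       (suc x) (there x∈) = x∉p-x p x x∈

∣p∣≤1+∣p-x∣ : ∀ {k} {p : Subset k} {x} → x ∈ p → ∣ p ∣ ≤ suc ∣ p - x ∣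
-- Removing the head element subtracts `⊥` from the tail.
∣p∣≤1+∣p-x∣ {p = inside ∷ p}  here        = s≤s (ℕ.≤-reflexive (cong ∣_∣ (sym (Subset.p─⊥≡p p))))
∣p∣≤1+∣p-x∣ {p = inside ∷ p}  (there x∈p) = s≤s (∣p∣≤1+∣p-x∣ x∈p)
∣p∣≤1+∣p-x∣ {p = outside ∷ p} (there x∈p) = ∣p∣≤1+∣p-x∣ x∈p

-- The nonzero coefficient is an explicit witness, so that it contradicts `vecMatroid` directly and
-- can be followed through an elimination step.
Dependence : ∀ {m E} → Matrix m E → Subset E → Set
Dependence {E = E} B I = Σ (Fin E → ℚ) λ c → (∀ e → e ∉ I → c e ≡ 0ℚ) ×
  (∀ i → sumFin (λ e → c e * B i e) ≡ 0ℚ) × ∃ λ e → c e ≢ 0ℚ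

-- Eliminating the pivot p without division: c' solves the reduced system
-- on I - p, and c e = c' e * B₀ p for e ≠ p, with c p = - Σ c' e * B₀ e.
module Elimination {m E} (B : Matrix (suc m) E) (p : Fin E) where

  B₀ : Fin E → ℚ
  B₀ = B zero

  reduced : Matrix m E
  reduced i e = B (suc i) e * B₀ p + - (B (suc i) p) * B₀ e

  lift : ∀ {I} → p ∈ I → B₀ p ≢ 0ℚ → Dependence reduced (I - p) → Dependence B I
  lift {I} p∈I B₀p≢0 (c' , supp , eqs , e₀ , c'e₀≢0) = c , c-supp , c-eqs , e₀ , ce₀≢0
    where
    s : ℚ
    s = sumFin (λ e → c' e * B₀ e)

    c : Fin E → ℚ
    c e = c' e * B₀ p + δ p e * - s

    c-supp : ∀ e → e ∉ I → c e ≡ 0ℚ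
    c-supp e e∉I = trans
      (cong₂ (λ x y → x * B₀ p + y * - s)
        (supp e (e∉I ∘ Subset.p─q⊆p I ⁅ p ⁆))
        (δ-≢ {i = p} {e} λ { refl → e∉I p∈I }))
      (solve 2 (λ a b → con0 :* a :+ con0 :* b := con0) refl (B₀ p) (- s))
      where con0 = +-*-Solver.con 0ℚ

    expand : ∀ h → sumFin (λ e → c e * h e) ≡ sumFin (λ e → c' e * h e) * B₀ p + h p * - s
    expand h = begin
      sumFin (λ e → c e * h e)
        ≡⟨ sum-cong (λ e → solve 5 (λ x b d s h → (x :* b :+ d :* s) :* h := x :* h :* b :+ d :* h :* s)
             refl (c' e) (B₀ p) (δ p e) (- s) (h e)) ⟩
      sumFin (λ e → c' e * h e * B₀ p + δ p e * h e * - s)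
        ≡⟨ sum-+ (λ e → c' e * h e * B₀ p) (λ e → δ p e * h e * - s) ⟩
      sumFin (λ e → c' e * h e * B₀ p) + sumFin (λ e → δ p e * h e * - s)
        ≡⟨ cong₂ _+_ (sum-*ʳ (λ e → c' e * h e) (B₀ p)) (sum-*ʳ (λ e → δ p e * h e) (- s)) ⟩
      sumFin (λ e → c' e * h e) * B₀ p + sumFin (λ e → δ p e * h e) * - s
        ≡⟨ cong (λ x → sumFin (λ e → c' e * h e) * B₀ p + x * - s) (trans
             (sum-single (λ e → δ p e * h e) p (λ e e≢p → *-zeroˡ′ (h e) (δ-≢ {i = p} {e} (e≢p ∘ sym))))
             (trans (cong (_* h p) (δ-refl p)) (ℚ.*-identityˡ (h p)))) ⟩
      sumFin (λ e → c' e * h e) * B₀ p + h p * - s ∎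

    c-eqs : ∀ i → sumFin (λ e → c e * B i e) ≡ 0ℚ
    c-eqs zero    = trans (expand B₀)
      (solve 2 (λ a b → a :* b :+ b :* (:- a) := +-*-Solver.con 0ℚ) refl s (B₀ p))
    c-eqs (suc i) = begin
      sumFin (λ e → c e * B (suc i) e)
        ≡⟨ expand (B (suc i)) ⟩
      sumFin (λ e → c' e * B (suc i) e) * B₀ p + B (suc i) p * - s
        ≡⟨ solve 4 (λ x b q s → x :* b :+ q :* (:- s) := x :* b :+ s :* (:- q)) refl
             (sumFin (λ e → c' e * B (suc i) e)) (B₀ p) (B (suc i) p) s ⟩
      sumFin (λ e → c' e * B (suc i) e) * B₀ p + s * - B (suc i) p
        ≡⟨ cong₂ _+_ (sum-*ʳ (λ e → c' e * B (suc i) e) (B₀ p)) (sum-*ʳ (λ e → c' e * B₀ e) (- B (suc i) p)) ⟨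
      sumFin (λ e → c' e * B (suc i) e * B₀ p) + sumFin (λ e → c' e * B₀ e * - B (suc i) p)
        ≡⟨ sum-+ (λ e → c' e * B (suc i) e * B₀ p) (λ e → c' e * B₀ e * - B (suc i) p) ⟨
      sumFin (λ e → c' e * B (suc i) e * B₀ p + c' e * B₀ e * - B (suc i) p)
        ≡⟨ sum-cong (λ e → solve 5 (λ x y b z q → x :* y :* b :+ x :* z :* q := x :* (y :* b :+ q :* z))
             refl (c' e) (B (suc i) e) (B₀ p) (B₀ e) (- B (suc i) p)) ⟩
      sumFin (λ e → c' e * reduced i e)
        ≡⟨ eqs i ⟩
      0ℚ ∎

    ce₀≢0 : c e₀ ≢ 0ℚ
    ce₀≢0 ce₀≡0 = p*q≢0 c'e₀≢0 B₀p≢0 (begin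
      c' e₀ * B₀ p              ≡⟨ solve 2 (λ a b → a := a :+ +-*-Solver.con 0ℚ :* b) refl (c' e₀ * B₀ p) (- s) ⟩
      c' e₀ * B₀ p + 0ℚ * - s   ≡⟨ cong (λ x → c' e₀ * B₀ p + x * - s) (δ-≢ {i = p} {e₀} p≢e₀) ⟨
      c e₀                      ≡⟨ ce₀≡0 ⟩
      0ℚ                        ∎)
      where
      p≢e₀ : p ≢ e₀
      -- `c'` vanishes outside `I - p`, hence at `p`.
      p≢e₀ refl = c'e₀≢0 (supp p (x∉p-x I p))

-- Gaussian elimination by induction over the rows, where `T` holds those that may be nonzero on
-- `I`. A row that vanishes on `I` imposes nothing; any other is eliminated through a pivot, which
-- shrinks `T` and `I` by one each.
dependent : ∀ {m E} (T : Subset m) (I : Subset E) (B : Matrix m E) →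
  (∀ i → i ∉ T → ∀ e → e ∈ I → B i e ≡ 0ℚ) → ∣ T ∣ < ∣ I ∣ → Dependence B I
dependent {E = E} [] I B _ 0<∣I∣ with Subset.nonempty? I
-- Without rows there are no equations, so any single element of `I` with coefficient 1 is a
-- dependence.
... | yes (p , p∈I) = δ p , (λ e e∉I → δ-≢ {i = p} {e} λ { refl → e∉I p∈I }) , (λ ()) ,
                      p , λ δ≡0 → ℚ.1≢0 (trans (sym (δ-refl p)) δ≡0)
... | no empty rewrite Subset.Empty-unique empty | Subset.∣⊥∣≡0 E = contradiction 0<∣I∣ λ ()
dependent (outside ∷ T) I B zeros T<I =
  let c , supp , eqs , nz = dependent T I (B ∘ suc) (λ i i∉T → zeros (suc i) λ { (there i∈T) → i∉T i∈T }) T<I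
  in c , supp , (λ { zero → sum-support I c (B zero) supp (zeros zero λ ()) ; (suc i) → eqs i }) , nz
dependent (inside ∷ T) I B zeros T<I with Fin.any? (λ e → e ∈? I ×-dec ¬? (B zero e ≟ 0ℚ))
... | no noPivot =
  let c , supp , eqs , nz = dependent T I (B ∘ suc) (λ i i∉T → zeros (suc i) λ { (there i∈T) → i∉T i∈T })
                              (ℕ.<-trans (ℕ.n<1+n _) T<I)
  in c , supp , (λ { zero → sum-support I c (B zero) supp row≡0 ; (suc i) → eqs i }) , nz
  where
  row≡0 : ∀ e → e ∈ I → B zero e ≡ 0ℚ
  row≡0 e e∈I with B zero e ≟ 0ℚ
  ... | yes ≡0 = ≡0
  ... | no ≢0  = contradiction (e , e∈I , ≢0) noPivot
... | yes (p , p∈I , B₀p≢0) = lift p∈I B₀p≢0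
    (dependent T (I - p) reduced zeros'
      (ℕ.s≤s⁻¹ (ℕ.≤-trans T<I (∣p∣≤1+∣p-x∣ p∈I))))
  where
  open Elimination B p
  zeros' : ∀ i → i ∉ T → ∀ e → e ∈ (I - p) → reduced i e ≡ 0ℚ
  -- A reduced entry combines the entries of the row at `e` and at `p`, and both are zero.
  zeros' i i∉T e e∈ = trans
    (cong₂ (λ x y → x * B₀ p + - y * B₀ e)
      (zeros (suc i) (λ { (there i∈T) → i∉T i∈T }) e (Subset.p─q⊆p I ⁅ p ⁆ e∈))
      (zeros (suc i) (λ { (there i∈T) → i∉T i∈T }) p p∈I))
    (solve 2 (λ a b → con0 :* a :+ (:- con0) :* b := con0) refl (B₀ p) (B₀ e))
    where con0 = +-*-Solver.con 0ℚ

-- Only the rows in T matter: on I, the others are multiples of one of them.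
∣independent∣≤ : ∀ {m E} (B : Matrix m E) (T : Subset m) (I : Subset E) {i₀} → i₀ ∈ T →
  (k : Fin m → ℚ) → (∀ i → i ∉ T → ∀ e → e ∈ I → B i e ≡ B i₀ e * k i) →
  vecMatroid B I → ∣ I ∣ ≤ ∣ T ∣
∣independent∣≤ {m} {E} B T I {i₀} i₀∈T k multiple indep = ℕ.≮⇒≥ λ T<I →
  -- `B'` keeps the rows in `T` and zeroes the rest. A dependence for `B'` also satisfies the rows
  -- of `B` outside `T`, since on `I` they are multiples of row `i₀`.
  let c , supp , eqs , e , ce≢0 = dependent T I B' (λ i i∉T e _ → B'-∉ i∉T e) T<I
  in ce≢0 (indep c supp (λ i → solves c supp eqs i (i ∈? T)) e)
  where
  B' : Matrix m E
  B' i e with i ∈? T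
  ... | yes _ = B i e
  ... | no  _ = 0ℚ

  B'-∈ : ∀ {i} → i ∈ T → ∀ e → B' i e ≡ B i e
  B'-∈ {i} i∈T e with i ∈? T
  ... | yes _  = refl
  ... | no i∉T = contradiction i∈T i∉T

  B'-∉ : ∀ {i} → i ∉ T → ∀ e → B' i e ≡ 0ℚ
  B'-∉ {i} i∉T e with i ∈? T
  ... | yes i∈T = contradiction i∈T i∉T
  ... | no _    = refl

  module _ (c : Fin E → ℚ) (supp : ∀ e → e ∉ I → c e ≡ 0ℚ)
           (eqs : ∀ i → sumFin (λ e → c e * B' i e) ≡ 0ℚ) where

    solves-∈ : ∀ {i} → i ∈ T → sumFin (λ e → c e * B i e) ≡ 0ℚ
    solves-∈ {i} i∈T = trans (sum-cong (λ e → cong (c e *_) (sym (B'-∈ i∈T e)))) (eqs i)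

    solves : ∀ i → Dec (i ∈ T) → sumFin (λ e → c e * B i e) ≡ 0ℚ
    solves i (yes i∈T) = solves-∈ i∈T
    solves i (no i∉T)  = begin
      sumFin (λ e → c e * B i e)          ≡⟨ sum-cong (λ e → entry e (e ∈? I)) ⟩
      sumFin (λ e → c e * B i₀ e * k i)   ≡⟨ sum-*ʳ (λ e → c e * B i₀ e) (k i) ⟩
      sumFin (λ e → c e * B i₀ e) * k i   ≡⟨ *-zeroˡ′ (k i) (solves-∈ i₀∈T) ⟩
      0ℚ                                  ∎
      where
      entry : ∀ e → Dec (e ∈ I) → c e * B i e ≡ c e * B i₀ e * k i
      entry e (yes e∈I) = trans (cong (c e *_) (multiple i i∉T e e∈I)) (sym (ℚ.*-assoc (c e) (B i₀ e) (k i)))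
      entry e (no e∉I)  = trans (*-zeroˡ′ (B i e) (supp e e∉I))
        (sym (*-zeroˡ′ (k i) (*-zeroˡ′ (B i₀ e) (supp e e∉I))))

-- Rank and separation in the matroid of [I | N]

two-members : ∀ {k} {p : Subset k} {x y} → x ≢ y → x ∈ p → y ∈ p → 2 ≤ ∣ p ∣
two-members x≢y x∈p y∈p = ℕ.≤-trans
  (s≤s (ℕ.≤-trans (s≤s z≤n) (Subset.x∈p⇒∣p-x∣<∣p∣ (Subset.x∈p∧x≢y⇒x∈p-y x∈p x≢y))))
  (Subset.x∈p⇒∣p-x∣<∣p∣ y∈p)

∣p∪⁅x⁆∣≤1+∣p∣ : ∀ {k} (p : Subset k) x → ∣ p ∪ ⁅ x ⁆ ∣ ≤ suc ∣ p ∣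
∣p∪⁅x⁆∣≤1+∣p∣ p x = ℕ.≤-trans
  (∣p∣≤1+∣p-x∣ {p = p ∪ ⁅ x ⁆} (Subset.x∈p∪q⁺ {p = p} (inj₂ (Subset.x∈⁅x⁆ x))))
  (s≤s (Subset.p⊆q⇒∣p∣≤∣q∣ sub))
  where
  sub : (p ∪ ⁅ x ⁆) - x ⊆ p
  sub {y} y∈ with Subset.x∈p∪q⁻ p ⁅ x ⁆ (Subset.p─q⊆p (p ∪ ⁅ x ⁆) ⁅ x ⁆ y∈)
  ... | inj₁ y∈p = y∈p
  ... | inj₂ y∈x with refl ← Subset.x∈⁅y⁆⇒x≡y x y∈x = contradiction y∈ (x∉p-x (p ∪ ⁅ x ⁆) x)

module _ {m n : ℕ} where

  -- Case distinction on the ground set of [I | N]: `i ↑ˡ n` is the identity column of row `i`, and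
  -- `m ↑ʳ j` is column `j` of `N`.
  ↑-elim : (P : Fin (m ℕ.+ n) → Set) → (∀ i → P (i ↑ˡ n)) → (∀ j → P (m ↑ʳ j)) → ∀ e → P e
  ↑-elim P left right e with splitAt m e in eq
  ... | inj₁ i = subst P (Fin.splitAt⁻¹-↑ˡ eq) (left i)
  ... | inj₂ j = subst P (Fin.splitAt⁻¹-↑ʳ {m} eq) (right j)

  module _ (p : Subset m) (q : Subset n) where

    ∈-++ˡ⁺ : ∀ {i} → i ∈ p → i ↑ˡ n ∈ p ++ q
    ∈-++ˡ⁺ {i} i∈p = lookup⇒[]= (i ↑ˡ n) (p ++ q) (trans (lookup-++ˡ p q i) ([]=⇒lookup i∈p))

    ∈-++ˡ⁻ : ∀ {i} → i ↑ˡ n ∈ p ++ q → i ∈ p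
    ∈-++ˡ⁻ {i} i∈ = lookup⇒[]= i p (trans (sym (lookup-++ˡ p q i)) ([]=⇒lookup i∈))

    ∈-++ʳ⁺ : ∀ {j} → j ∈ q → m ↑ʳ j ∈ p ++ q
    ∈-++ʳ⁺ {j} j∈q = lookup⇒[]= (m ↑ʳ j) (p ++ q) (trans (lookup-++ʳ p q j) ([]=⇒lookup j∈q))

    ∈-++ʳ⁻ : ∀ {j} → m ↑ʳ j ∈ p ++ q → j ∈ q
    ∈-++ʳ⁻ {j} j∈ = lookup⇒[]= j q (trans (sym (lookup-++ʳ p q j)) ([]=⇒lookup j∈))

∣p++q∣ : ∀ {m n} (p : Subset m) (q : Subset n) → ∣ p ++ q ∣ ≡ ∣ p ∣ ℕ.+ ∣ q ∣
∣p++q∣ []            q = refl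
∣p++q∣ (inside  ∷ p) q = cong suc (∣p++q∣ p q)
∣p++q∣ (outside ∷ p) q = ∣p++q∣ p q

module _ {m n} (N : Matrix m n) where

  IN-identity : ∀ i i' → IN N i (i' ↑ˡ n) ≡ δ i i'
  IN-identity i i' rewrite Fin.splitAt-↑ˡ m i' n with i Fin.≟ i'
  ... | yes _ = refl
  ... | no  _ = refl

  IN-matrix : ∀ i j → IN N i (m ↑ʳ j) ≡ N i j
  IN-matrix i j rewrite Fin.splitAt-↑ʳ m n j = refl

  IN-combination : ∀ (c : Fin (m ℕ.+ n) → ℚ) i →
    sumFin (λ e → c e * IN N i e) ≡ c (i ↑ˡ n) + sumFin (λ j → c (m ↑ʳ j) * N i j)
  IN-combination c i = trans (sum-splitAt m (λ e → c e * IN N i e)) (cong₂ _+_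
    (begin
      sumFin (λ i' → c (i' ↑ˡ n) * IN N i (i' ↑ˡ n))
        ≡⟨ sum-cong (λ i' → cong (c (i' ↑ˡ n) *_) (IN-identity i i')) ⟩
      sumFin (λ i' → c (i' ↑ˡ n) * δ i i')
        ≡⟨ sum-single (λ i' → c (i' ↑ˡ n) * δ i i') i
             (λ i' i'≢i → *-zeroʳ′ (c (i' ↑ˡ n)) (δ-≢ {i = i} {i'} (i'≢i ∘ sym))) ⟩
      c (i ↑ˡ n) * δ i i
        ≡⟨ cong (c (i ↑ˡ n) *_) (δ-refl i) ⟩
      c (i ↑ˡ n) * 1ℚ
        ≡⟨ ℚ.*-identityʳ (c (i ↑ˡ n)) ⟩
      c (i ↑ˡ n) ∎)
    (sum-cong (λ j → cong (c (m ↑ʳ j) *_) (IN-matrix i j))))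

  -- Once the columns of `N` have coefficient zero, equation `i` reads `c (i ↑ˡ n) ≡ 0ℚ`.
  matrixPart≡0⇒≡0 : ∀ (c : Fin (m ℕ.+ n) → ℚ) → (∀ i → sumFin (λ e → c e * IN N i e) ≡ 0ℚ) →
    (∀ j → c (m ↑ʳ j) ≡ 0ℚ) → ∀ e → c e ≡ 0ℚ
  matrixPart≡0⇒≡0 c eqs cʳ≡0 = ↑-elim (λ e → c e ≡ 0ℚ) cˡ≡0 cʳ≡0
    where
    cˡ≡0 : ∀ i → c (i ↑ˡ n) ≡ 0ℚ
    cˡ≡0 i = begin
      c (i ↑ˡ n)                                       ≡⟨ ℚ.+-identityʳ (c (i ↑ˡ n)) ⟨
      c (i ↑ˡ n) + 0ℚ                                  ≡⟨ cong (c (i ↑ˡ n) +_) (sum-zero (λ j → *-zeroˡ′ (N i j) (cʳ≡0 j))) ⟨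
      c (i ↑ˡ n) + sumFin (λ j → c (m ↑ʳ j) * N i j)   ≡⟨ IN-combination c i ⟨
      sumFin (λ e → c e * IN N i e)                    ≡⟨ eqs i ⟩
      0ℚ                                               ∎

  rows-independent : ∀ (p : Subset m) → matroidOf N (p ++ ⊥)
  rows-independent p c supp eqs = matrixPart≡0⇒≡0 c eqs
    (λ j → supp (m ↑ʳ j) (Subset.∉⊥ ∘ ∈-++ʳ⁻ p ⊥))

  -- In row `i` no identity column from `p` contributes, so its equation reduces to
  -- `c (m ↑ʳ j) * N i j ≡ 0ℚ`.
  rows+column-independent : ∀ (p : Subset m) {i j} → i ∉ p → N i j ≢ 0ℚ → matroidOf N (p ++ ⁅ j ⁆)
  rows+column-independent p {i} {j} i∉p Nij≢0 c supp eqs = matrixPart≡0⇒≡0 c eqs cʳ≡0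
    where
    cʳ-other : ∀ j' → j' ≢ j → c (m ↑ʳ j') ≡ 0ℚ
    cʳ-other j' j'≢j = supp (m ↑ʳ j') (Subset.x≢y⇒x∉⁅y⁆ j'≢j ∘ ∈-++ʳ⁻ p ⁅ j ⁆)

    product≡0 : c (m ↑ʳ j) * N i j ≡ 0ℚ
    product≡0 = begin
      c (m ↑ʳ j) * N i j
        ≡⟨ sum-single (λ j' → c (m ↑ʳ j') * N i j') j (λ j' j'≢j → *-zeroˡ′ (N i j') (cʳ-other j' j'≢j)) ⟨
      sumFin (λ j' → c (m ↑ʳ j') * N i j')
        ≡⟨ ℚ.+-identityˡ _ ⟨
      0ℚ + sumFin (λ j' → c (m ↑ʳ j') * N i j')
        ≡⟨ cong (_+ sumFin (λ j' → c (m ↑ʳ j') * N i j')) (supp (i ↑ˡ n) (i∉p ∘ ∈-++ˡ⁻ p ⁅ j ⁆)) ⟨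
      c (i ↑ˡ n) + sumFin (λ j' → c (m ↑ʳ j') * N i j')
        ≡⟨ IN-combination c i ⟨
      sumFin (λ e → c e * IN N i e)
        ≡⟨ eqs i ⟩
      0ℚ ∎

    cʳ≡0 : ∀ j' → c (m ↑ʳ j') ≡ 0ℚ
    cʳ≡0 j' with j' Fin.≟ j
    ... | no j'≢j = cʳ-other j' j'≢j
    ... | yes refl with c (m ↑ʳ j) ≟ 0ℚ
    ...   | yes ≡0 = ≡0
    ...   | no ≢0  = contradiction product≡0 (p*q≢0 ≢0 Nij≢0)

  -- N = [ A 0 ; B D ] with the rows of A indexed by S, its columns by Q,
  -- and B of rank one: the partition (S ++ Q , rest) has connectivity 1.
  rankOne-separation : (S : Subset m) (Q : Subset n) {i₁ i₂ : Fin m} {j₁ j₂ : Fin n} →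
    i₁ ≢ i₂ → j₁ ≢ j₂ → i₁ ∉ S → i₂ ∉ S → j₁ ∈ Q → j₂ ∈ Q → N i₁ j₁ ≢ 0ℚ →
    (∀ i j → i ∈ S → j ∉ Q → N i j ≡ 0ℚ) →
    (k : Fin m → ℚ) → (∀ i j → i ∉ S → j ∈ Q → N i j ≡ N i₁ j * k i) →
    Separation (matroidOf N) 2
  rankOne-separation S Q {i₁} {i₂} {j₁} {j₂} i₁≢i₂ j₁≢j₂ i₁∉S i₂∉S j₁∈Q j₂∈Q N₁₁≢0 upper≡0 k lower =
    X , suc ∣ S ∣ , ∣ ∁ S ∣ , m , rank-X , rank-∁X , rank-⊤ ,
    two-members (j₁≢j₂ ∘ Fin.↑ʳ-injective m j₁ j₂) (∈-++ʳ⁺ S Q j₁∈Q) (∈-++ʳ⁺ S Q j₂∈Q) ,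
    two-members (i₁≢i₂ ∘ Fin.↑ˡ-injective n i₁ i₂) (row∈∁X i₁∉S) (row∈∁X i₂∉S) ,
    -- The two ranks add up to (1 + |S|) + (m - |S|) = m + 1, which is below 2 + m.
    s≤s (s≤s (ℕ.≤-reflexive (trans (cong (∣ S ∣ ℕ.+_) (Subset.∣∁p∣≡n∸∣p∣ S)) (ℕ.m+[n∸m]≡n (Subset.∣p∣≤n S)))))
    where
    X : Subset (m ℕ.+ n)
    X = S ++ Q

    row∈∁X : ∀ {i} → i ∉ S → i ↑ˡ n ∈ ∁ X
    row∈∁X i∉S = Subset.x∉p⇒x∈∁p (i∉S ∘ ∈-++ˡ⁻ S Q)

    IN-≢ : ∀ {i i'} → i ≢ i' → IN N i (i' ↑ˡ n) ≡ 0ℚ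
    IN-≢ {i} {i'} i≢i' = trans (IN-identity i i') (δ-≢ {i = i} {i'} i≢i')

    X-multiple : ∀ i → i ∉ S → ∀ e → e ∈ X → IN N i e ≡ IN N i₁ e * k i
    X-multiple i i∉S = ↑-elim _
      -- An identity column of `S` is zero in both rows, as `i` and `i₁` lie outside `S`.
      (λ i' i'∈X → let i'∈S = ∈-++ˡ⁻ S Q i'∈X in
        trans (IN-≢ λ { refl → i∉S i'∈S })
              (sym (*-zeroˡ′ (k i) (IN-≢ λ { refl → i₁∉S i'∈S }))))
      (λ j j∈X → trans (IN-matrix i j) (trans (lower i j i∉S (∈-++ʳ⁻ S Q j∈X))
        (cong (_* k i) (sym (IN-matrix i₁ j)))))

    ∁X-zero : ∀ i → i ∈ S → ∀ e → e ∈ ∁ X → IN N i e ≡ 0ℚ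
    ∁X-zero i i∈S = ↑-elim _
      (λ i' i'∈∁X → IN-≢ λ { refl → Subset.x∈∁p⇒x∉p i'∈∁X (∈-++ˡ⁺ S Q i∈S) })
      (λ j j∈∁X → trans (IN-matrix i j) (upper≡0 i j i∈S (Subset.x∈∁p⇒x∉p j∈∁X ∘ ∈-++ʳ⁺ S Q)))

    -- The identity columns of `S` and column `j₁` form a basis: on `X` every row outside `S` is a
    -- multiple of row `i₁`, so the rows `S ∪ ⁅ i₁ ⁆` bound the rank.
    rank-X : HasRank (matroidOf N) X (suc ∣ S ∣)
    rank-X = (S ++ ⁅ j₁ ⁆ , sub _ , rows+column-independent S i₁∉S N₁₁≢0 ,
              trans (∣p++q∣ S ⁅ j₁ ⁆) (trans (cong (∣ S ∣ ℕ.+_) (Subset.∣⁅x⁆∣≡1 j₁)) (ℕ.+-comm ∣ S ∣ 1))) ,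
      λ I I⊆X indep → ℕ.≤-trans
        (∣independent∣≤ (IN N) (S ∪ ⁅ i₁ ⁆) I (Subset.x∈p∪q⁺ (inj₂ (Subset.x∈⁅x⁆ i₁))) k
          (λ i i∉T e e∈I → X-multiple i (i∉T ∘ Subset.x∈p∪q⁺ ∘ inj₁) e (I⊆X e∈I)) indep)
        (∣p∪⁅x⁆∣≤1+∣p∣ S i₁)
      where
      sub : ∀ e → e ∈ S ++ ⁅ j₁ ⁆ → e ∈ X
      sub = ↑-elim _ (λ i i∈ → ∈-++ˡ⁺ S Q (∈-++ˡ⁻ S ⁅ j₁ ⁆ i∈))
        (λ j j∈ → ∈-++ʳ⁺ S Q (subst (_∈ Q) (sym (Subset.x∈⁅y⁆⇒x≡y j₁ (∈-++ʳ⁻ S ⁅ j₁ ⁆ j∈))) j₁∈Q))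

    ∣p++⊥∣ : ∀ (p : Subset m) → ∣ p ++ ⊥ {n} ∣ ≡ ∣ p ∣
    ∣p++⊥∣ p = trans (∣p++q∣ p ⊥) (trans (cong (∣ p ∣ ℕ.+_) (Subset.∣⊥∣≡0 n)) (ℕ.+-identityʳ ∣ p ∣))

    -- The rows in `S` vanish on `∁ X`, so they count as multiples with factor 0 and the rows in
    -- `∁ S` bound the rank.
    rank-∁X : HasRank (matroidOf N) (∁ X) ∣ ∁ S ∣
    rank-∁X = (∁ S ++ ⊥ , sub _ , rows-independent (∁ S) , ∣p++⊥∣ (∁ S)) ,
      λ I I⊆∁X → ∣independent∣≤ (IN N) (∁ S) I (Subset.x∉p⇒x∈∁p i₁∉S) (λ _ → 0ℚ)
        (λ i i∉∁S e e∈I → trans (∁X-zero i (Subset.x∉∁p⇒x∈p i∉∁S) e (I⊆∁X e∈I)) (sym (ℚ.*-zeroʳ (IN N i₁ e))))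
      where
      sub : ∀ e → e ∈ ∁ S ++ ⊥ → e ∈ ∁ X
      sub = ↑-elim _ (λ i i∈ → row∈∁X (Subset.x∈∁p⇒x∉p (∈-++ˡ⁻ (∁ S) ⊥ i∈)))
        (λ j j∈ → contradiction (∈-++ʳ⁻ (∁ S) ⊥ j∈) Subset.∉⊥)

    rank-⊤ : HasRank (matroidOf N) ⊤ m
    rank-⊤ = (⊤ {m} ++ ⊥ {n} , (λ _ → Subset.∈⊤) , rows-independent ⊤ , trans (∣p++⊥∣ ⊤) (Subset.∣⊤∣≡n m)) ,
      λ I _ indep → ℕ.≤-trans
        (∣independent∣≤ (IN N) ⊤ I {i₁} Subset.∈⊤ (λ _ → 0ℚ) (λ i i∉⊤ → contradiction Subset.∈⊤ i∉⊤) indep)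
        (ℕ.≤-reflexive (Subset.∣⊤∣≡n m))

-- Finite search and stabilisation

⟦_⟧ : ∀ {k} {P : Fin k → Set} → (∀ i → Dec (P i)) → Subset k
⟦ P? ⟧ = tabulate (does ∘ P?)

∈⟦⟧⁺ : ∀ {k} {P : Fin k → Set} (P? : ∀ i → Dec (P i)) {i} → P i → i ∈ ⟦ P? ⟧
∈⟦⟧⁺ P? {i} Pi = lookup⇒[]= i ⟦ P? ⟧ (trans (lookup∘tabulate (does ∘ P?) i) (dec-true (P? i) Pi))

∈⟦⟧⁻ : ∀ {k} {P : Fin k → Set} (P? : ∀ i → Dec (P i)) {i} → i ∈ ⟦ P? ⟧ → P i
∈⟦⟧⁻ P? {i} i∈ with P? i | trans (sym (lookup∘tabulate (does ∘ P?) i)) ([]=⇒lookup i∈)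
... | yes Pi | _  = Pi
... | no _   | ()

-- As long as no step is stable, the set gains an element at each step; after `suc n` steps it would
-- exceed `Fin n`.
stabilises : ∀ {n} (P : ℕ → Fin n → Set) → (∀ t j → Dec (P t j)) → (∀ t j → P t j → P (suc t) j) →
  ∃ λ t → ∀ j → P (suc t) j → P t j
stabilises {n} P P? mono with growth (suc n)
  where
  Stable : ℕ → Set
  Stable t = ∀ j → P (suc t) j → P t j

  growth : ∀ t → ∃ Stable ⊎ t ≤ ∣ ⟦ P? t ⟧ ∣
  growth zero    = inj₂ z≤n
  growth (suc t) with growth t | Fin.all? (λ j → P? (suc t) j →-dec P? t j)
  ... | inj₁ found | _          = inj₁ found
  ... | _          | yes stable = inj₁ (t , stable)
  ... | inj₂ t≤    | no ¬stable =
    -- Instability yields an element of stage `suc t` that is missing at stage `t`.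
    let j , ¬imp = Fin.¬∀⟶∃¬ n _ (λ j → P? (suc t) j →-dec P? t j) ¬stable
        new      = decidable-stable (P? (suc t) j) λ ¬P → ¬imp λ P → contradiction P ¬P
    in inj₂ (ℕ.≤-trans (s≤s t≤) (Subset.p⊂q⇒∣p∣<∣q∣
         ( (λ {i} i∈ → ∈⟦⟧⁺ (P? (suc t)) (mono t i (∈⟦⟧⁻ (P? t) i∈)))
         , j , ∈⟦⟧⁺ (P? (suc t)) new , λ j∈ → ¬imp λ _ → ∈⟦⟧⁻ (P? t) j∈)))
... | inj₁ found = found
... | inj₂ n<    = contradiction (ℕ.≤-trans n< (Subset.∣p∣≤n ⟦ P? (suc n) ⟧)) (ℕ.<-irrefl refl)

least : (Q : ℕ → Set) → (∀ t → Dec (Q t)) → ∀ t → Q t → ∃ λ s → Q s × (∀ r → Q r → s ≤ r)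
least Q Q? t Qt with Q? zero
... | yes Q0 = zero , Q0 , λ _ _ → z≤n
least Q Q? zero    Qt | no ¬Q0 = contradiction Qt ¬Q0
least Q Q? (suc t) Qt | no ¬Q0 =
  let s , Qs , min = least (Q ∘ suc) (Q? ∘ suc) t Qt
  in suc s , Qs , λ { zero Q0 → contradiction Q0 ¬Q0 ; (suc r) Qr → s≤s (min r Qr) }

-- Total unimodularity on small submatrices; zeroing one entry.

Unimodular : ℚ → Set
Unimodular d = (d ≡ 0ℚ) ⊎ (d ≡ 1ℚ) ⊎ (d ≡ - 1ℚ)

-- Distinct signs differ by 2 or -2.
unimodular-difference : ∀ {p q} → IsSign p → IsSign q → Unimodular (p + - q) → p ≡ q
unimodular-difference (inj₁ refl) (inj₁ refl) _ = refl
unimodular-difference (inj₂ refl) (inj₂ refl) _ = refl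
unimodular-difference (inj₁ refl) (inj₂ refl) (inj₁ ())
unimodular-difference (inj₁ refl) (inj₂ refl) (inj₂ (inj₁ ()))
unimodular-difference (inj₁ refl) (inj₂ refl) (inj₂ (inj₂ ()))
unimodular-difference (inj₂ refl) (inj₁ refl) (inj₁ ())
unimodular-difference (inj₂ refl) (inj₁ refl) (inj₂ (inj₁ ()))
unimodular-difference (inj₂ refl) (inj₁ refl) (inj₂ (inj₂ ()))

module _ {m n} (N : Matrix m n) (tu : TU N) where

  TU-entry : ∀ i j → N i j ≢ 0ℚ → IsSign (N i j)
  TU-entry i j N≢0 with subst Unimodular
    -- The left side is the unfolded `det` of a 1×1 matrix.
    (solve 1 (λ a → con1 :* (a :* con1) :+ +-*-Solver.con 0ℚ := a) refl (N i j))
    (tu 1 (λ _ → i) (λ _ → j) (λ { {zero} {zero} _ → refl }) (λ { {zero} {zero} _ → refl }))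
    where con1 = +-*-Solver.con 1ℚ
  ... | inj₁ N≡0  = contradiction N≡0 N≢0
  ... | inj₂ sign = sign

  TU-2×2 : ∀ {i i' j j'} → N i j ≢ 0ℚ → N i j' ≢ 0ℚ → N i' j ≢ 0ℚ → N i' j' ≢ 0ℚ →
    N i j * N i' j' ≡ N i j' * N i' j
  TU-2×2 {i} {i'} {j} {j'} a≢0 b≢0 c≢0 d≢0 with i Fin.≟ i' | j Fin.≟ j'
  ... | yes refl | _        = ℚ.*-comm (N i j) (N i j')
  ... | no _     | yes refl = refl
  ... | no i≢i'  | no j≢j'  = unimodular-difference
    (sign-* (TU-entry i j a≢0) (TU-entry i' j' d≢0))
    (sign-* (TU-entry i j' b≢0) (TU-entry i' j c≢0))
    (subst Unimodular
      (solve 4 (λ a b c d → con1 :* (a :* (con1 :* (d :* con1) :+ con0))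
                            :+ ((:- con1) :* (b :* (con1 :* (c :* con1) :+ con0)) :+ con0)
                            := a :* d :+ (:- (b :* c)))
        refl (N i j) (N i j') (N i' j) (N i' j'))
      (tu 2 (pair i i') (pair j j') (pair-injective i≢i') (pair-injective j≢j')))
    where
    con0 = +-*-Solver.con 0ℚ
    con1 = +-*-Solver.con 1ℚ

    pair : ∀ {k} → Fin k → Fin k → Fin 2 → Fin k
    pair x y zero    = x
    pair x y (suc _) = y

    pair-injective : ∀ {k} {x y : Fin k} → x ≢ y → Injective _≡_ _≡_ (pair x y)
    pair-injective x≢y {zero}     {zero}     _  = refl
    pair-injective x≢y {zero}     {suc zero} eq = contradiction eq x≢y
    pair-injective x≢y {suc zero} {zero}     eq = contradiction (sym eq) x≢y
    pair-injective x≢y {suc zero} {suc zero} _  = refl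

module _ {m n} (N : Matrix m n) where

  zeroEntry-≡ : ∀ i j → zeroEntry N i j i j ≡ 0ℚ
  zeroEntry-≡ i j with i Fin.≟ i | j Fin.≟ j
  ... | yes _  | yes _  = refl
  ... | no i≢i | _      = contradiction refl i≢i
  ... | yes _  | no j≢j = contradiction refl j≢j

  zeroEntry-row : ∀ {i i'} j j' → i ≢ i' → zeroEntry N i j i' j' ≡ N i' j'
  zeroEntry-row {i} {i'} j j' i≢i' with i Fin.≟ i' | j Fin.≟ j'
  ... | yes i≡i' | _     = contradiction i≡i' i≢i'
  ... | no _     | yes _ = refl
  ... | no _     | no _  = refl

  zeroEntry-column : ∀ i i' {j j'} → j ≢ j' → zeroEntry N i j i' j' ≡ N i' j'
  zeroEntry-column i i' {j} {j'} j≢j' with i Fin.≟ i' | j Fin.≟ j'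
  ... | _     | yes j≡j' = contradiction j≡j' j≢j'
  ... | yes _ | no _     = refl
  ... | no _  | no _     = refl

-- Closing {i₁, i₂} under common neighbourhoods gives a maximal block of
-- nonzero entries.
module Block {m n} (N : Matrix m n) (i₁ i₂ : Fin m) where

  InC : Fin n → Set
  InC j = N i₁ j ≢ 0ℚ × N i₂ j ≢ 0ℚ

  InR : Fin m → Set
  InR i = ∀ j → InC j → N i j ≢ 0ℚ

  Edge : Fin m → Fin n → Set
  Edge i j = N i j ≢ 0ℚ × ¬ (InR i × InC j)

  N≢0? : ∀ i j → Dec (N i j ≢ 0ℚ)
  N≢0? i j = ¬? (N i j ≟ 0ℚ)

  InC? : ∀ j → Dec (InC j)
  InC? j = N≢0? i₁ j ×-dec N≢0? i₂ j

  InR? : ∀ i → Dec (InR i)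
  InR? i = Fin.all? (λ j → InC? j →-dec N≢0? i j)

  Edge? : ∀ i j → Dec (Edge i j)
  Edge? i j = N≢0? i j ×-dec ¬? (InR? i ×-dec InC? j)

  -- Distances to C in the bipartite graph of the entries outside the block:
  -- ColWithin t means at most 2t, RowWithin t at most 2t + 1.
  ColWithin : ℕ → Fin n → Set
  RowWithin : ℕ → Fin m → Set
  ColWithin zero    j = InC j
  ColWithin (suc t) j = ColWithin t j ⊎ ∃ λ i → RowWithin t i × Edge i j
  RowWithin t i = ∃ λ j → ColWithin t j × Edge i j

  ColWithin? : ∀ t j → Dec (ColWithin t j)
  RowWithin? : ∀ t i → Dec (RowWithin t i)
  ColWithin? zero    j = InC? j
  ColWithin? (suc t) j = ColWithin? t j ⊎-dec Fin.any? (λ i → RowWithin? t i ×-dec Edge? i j)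
  RowWithin? t i = Fin.any? (λ j → ColWithin? t j ×-dec Edge? i j)

  RowAt : ℕ → Fin m → Set
  RowAt t i = RowWithin t i × (∀ s → RowWithin s i → t ≤ s)

  ColAt : ℕ → Fin n → Set
  ColAt t j = ColWithin t j × (∀ s → ColWithin s j → t ≤ s)

  InC⇒ColWithin : ∀ t j → InC j → ColWithin t j
  InC⇒ColWithin zero    j j∈C = j∈C
  InC⇒ColWithin (suc t) j j∈C = inj₁ (InC⇒ColWithin t j j∈C)

  -- The index runs from the row `i` towards C while the level `t ∸ toℕ s` falls to 0. Exact levels
  -- are stored because they alone rule out repeated vertices and chords.
  record Path (t : ℕ) (i : Fin m) : Set where
    field
      f       : Fin (suc t) → Fin m
      g       : Fin (suc t) → Fin n
      f-start : f zero ≡ i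
      f-level : ∀ s → RowAt (t ∸ toℕ s) (f s)
      g-level : ∀ s → ColAt (t ∸ toℕ s) (g s)
      edge    : ∀ s → Edge (f s) (g s)
      edge′   : ∀ s → Edge (f (suc s)) (g (inject₁ s))

  -- Unfolds the evidence of reachability. Minimality passes down the path, since a shorter way from
  -- a later vertex to C would shorten the way from `i`.
  path : ∀ t i → RowAt t i → Path t i
  path zero i at@((j , j∈C , e) , _) = record
    { f = λ _ → i ; g = λ _ → j ; f-start = refl
    ; f-level = λ { zero → at } ; g-level = λ { zero → j∈C , λ _ _ → z≤n }
    ; edge = λ _ → e ; edge′ = λ () }
  -- A column already within `t` would put `i` at level `t`.
  path (suc t) i ((j , inj₁ col , e) , min) = contradiction (min t (j , col , e)) (ℕ.<-irrefl refl)
  path (suc t) i at@((j , col@(inj₂ (i' , row , e')) , e) , min) = record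
    { f = λ { zero → i ; (suc s) → P.f s } ; g = λ { zero → j ; (suc s) → P.g s } ; f-start = refl
    ; f-level = λ { zero → at ; (suc s) → P.f-level s }
    ; g-level = λ { zero → j-at ; (suc s) → P.g-level s }
    ; edge = λ { zero → e ; (suc s) → P.edge s }
    ; edge′ = λ { zero → subst (λ x → Edge x j) (sym P.f-start) e' ; (suc s) → P.edge′ s } }
    where
    j-at : ColAt (suc t) j
    j-at = col , λ s col-s → min s (j , col-s , e)

    i'-at : RowAt t i'
    i'-at = row , λ s row-s → ℕ.s≤s⁻¹ (proj₂ j-at (suc s) (inj₂ (i' , row-s , e')))

    module P = Path (path t i' i'-at)

  -- An edge prolongs a shortest path at either end: `i` is reached through `j` at level `b`, and
  -- `j` through `i` at level `suc a`.
  edge-levels : ∀ {a b i j} → RowAt a i → ColAt b j → Edge i j → a ≤ b × b ≤ suc a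
  edge-levels {a} {b} {i} {j} (row , row-min) (col , col-min) e =
    row-min b (j , col , e) , col-min (suc a) (inj₂ (i , row , e))

  -- Take the reached rows and columns. No edge leads from them to the rest, so a nonzero entry in
  -- an unreached row and a reached column lies in the block, which has rank one.
  unreachable⇒separation : TU N → ∀ {j₁ j₂} → i₁ ≢ i₂ → j₁ ≢ j₂ → InC j₁ → InC j₂ →
    ∀ t → (∀ j → ColWithin (suc t) j → ColWithin t j) → (∀ i → InR i → ¬ RowWithin t i) →
    Separation (matroidOf N) 2
  unreachable⇒separation tu {j₁} i₁≢i₂ j₁≢j₂ j₁∈C j₂∈C t stable unreachable =
    rankOne-separation N S Q i₁≢i₂ j₁≢j₂ (R∉S (λ _ → proj₁)) (R∉S (λ _ → proj₂))
      (C∈Q j₁∈C) (C∈Q j₂∈C) (proj₁ j₁∈C) upper≡0 (λ i → ratio (InR? i)) λ i j i∉S j∈Q → lower i j i∉S j∈Q (InR? i)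
    where
    S : Subset m
    S = ⟦ RowWithin? t ⟧

    Q : Subset n
    Q = ⟦ ColWithin? t ⟧

    R∉S : ∀ {i} → InR i → i ∉ S
    R∉S i∈R i∈S = unreachable _ i∈R (∈⟦⟧⁻ (RowWithin? t) i∈S)

    C∈Q : ∀ {j} → InC j → j ∈ Q
    C∈Q j∈C = ∈⟦⟧⁺ (ColWithin? t) (InC⇒ColWithin t _ j∈C)

    no-edge : ∀ i j → ¬ Edge i j → ¬ (InR i × InC j) → N i j ≡ 0ℚ
    no-edge i j ¬e outside-block = decidable-stable (N i j ≟ 0ℚ) λ N≢0 → ¬e (N≢0 , outside-block)

    upper≡0 : ∀ i j → i ∈ S → j ∉ Q → N i j ≡ 0ℚ
    upper≡0 i j i∈S j∉Q = no-edge i j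
      (λ e → j∉Q (∈⟦⟧⁺ (ColWithin? t) (stable j (inj₂ (i , ∈⟦⟧⁻ (RowWithin? t) i∈S , e)))))
      (λ { (_ , j∈C) → j∉Q (C∈Q j∈C) })

    lower-no-edge : ∀ i j → i ∉ S → j ∈ Q → ¬ Edge i j
    lower-no-edge i j i∉S j∈Q e = i∉S (∈⟦⟧⁺ (RowWithin? t) (j , ∈⟦⟧⁻ (ColWithin? t) j∈Q , e))

    -- For a row in R this is the quotient of `N i j₁` by `N i₁ j₁`, as a sign is its own inverse.
    ratio : ∀ {i} → Dec (InR i) → ℚ
    ratio {i} (yes _) = N i j₁ * N i₁ j₁
    ratio     (no _)  = 0ℚ

    lower : ∀ i j → i ∉ S → j ∈ Q → (i∈R? : Dec (InR i)) → N i j ≡ N i₁ j * ratio i∈R?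
    lower i j i∉S j∈Q (no i∉R) = trans
      (no-edge i j (lower-no-edge i j i∉S j∈Q) (i∉R ∘ proj₁)) (sym (ℚ.*-zeroʳ (N i₁ j)))
    lower i j i∉S j∈Q (yes i∈R) with InC? j
    -- Outside C both `N i j` and `N i₁ j` vanish, as `i₁` is also an unreached row.
    ... | no j∉C = trans
      (no-edge i j (lower-no-edge i j i∉S j∈Q) (j∉C ∘ proj₂))
      (sym (*-zeroˡ′ (N i j₁ * N i₁ j₁)
        (no-edge i₁ j (lower-no-edge i₁ j (R∉S (λ _ → proj₁)) j∈Q) (j∉C ∘ proj₂))))
    ... | yes j∈C = begin
      N i j                        ≡⟨ ℚ.*-identityʳ (N i j) ⟨
      N i j * 1ℚ                   ≡⟨ cong (N i j *_) (sign-square (TU-entry N tu i₁ j₁ (proj₁ j₁∈C))) ⟨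
      N i j * (N i₁ j₁ * N i₁ j₁)  ≡⟨ ℚ.*-assoc (N i j) (N i₁ j₁) (N i₁ j₁) ⟨
      N i j * N i₁ j₁ * N i₁ j₁    ≡⟨ cong (_* N i₁ j₁)
                                        (TU-2×2 N tu {i} {i₁} {j} {j₁} (i∈R j j∈C) (i∈R j₁ j₁∈C) (proj₁ j∈C) (proj₁ j₁∈C)) ⟩
      N i j₁ * N i₁ j * N i₁ j₁    ≡⟨ solve 3 (λ a b c → a :* b :* c := b :* (a :* c)) refl (N i j₁) (N i₁ j) (N i₁ j₁) ⟩
      N i₁ j * (N i j₁ * N i₁ j₁)  ∎

-- The shortest path, closed by a block entry, and its two determinants.

cons : ∀ {k} {A : Set} → A → (Fin k → A) → Fin (suc k) → A
cons x f zero    = x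
cons x f (suc i) = f i

cons-injective : ∀ {k} {A : Set} {x : A} {f : Fin k → A} → (∀ i → x ≢ f i) →
  Injective _≡_ _≡_ f → Injective _≡_ _≡_ (cons x f)
cons-injective x∉f f-inj {zero}  {zero}  _  = refl
cons-injective x∉f f-inj {zero}  {suc j} eq = contradiction eq (x∉f j)
cons-injective x∉f f-inj {suc i} {zero}  eq = contradiction (sym eq) (x∉f i)
cons-injective x∉f f-inj {suc i} {suc j} eq = cong suc (f-inj eq)

¬unimodular-double : ∀ {p} → IsSign p → ¬ Unimodular (p + p)
¬unimodular-double (inj₁ refl) (inj₁ ())
¬unimodular-double (inj₁ refl) (inj₂ (inj₁ ()))
¬unimodular-double (inj₁ refl) (inj₂ (inj₂ ()))
¬unimodular-double (inj₂ refl) (inj₁ ())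
¬unimodular-double (inj₂ refl) (inj₂ (inj₁ ()))
¬unimodular-double (inj₂ refl) (inj₂ (inj₂ ()))

-- The difference forces `p ≡ q` after cancelling the sign `x`, and then the sum is 2 or -2.
¬unimodular-both : ∀ {x p q} → IsSign x → IsSign p → IsSign q →
  Unimodular (p + q) → ¬ Unimodular (x * p + - (x * q))
¬unimodular-both {x} {p} {q} x± p± q± p+q xp-xq =
  ¬unimodular-double p± (subst (λ r → Unimodular (p + r)) (sym p≡q) p+q)
  where
  x*x*r≡r : ∀ r → x * (x * r) ≡ r
  x*x*r≡r r = trans (sym (ℚ.*-assoc x x r)) (trans (cong (_* r) (sign-square x±)) (ℚ.*-identityˡ r))

  p≡q : p ≡ q
  p≡q = begin
    p            ≡⟨ x*x*r≡r p ⟨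
    x * (x * p)  ≡⟨ cong (x *_) (unimodular-difference (sign-* x± p±) (sign-* x± q±) xp-xq) ⟩
    x * (x * q)  ≡⟨ x*x*r≡r q ⟩
    q            ∎

-- The level is a successor because a row of R at level 0 would have an edge into C, and `Edge`
-- excludes the block.
module ShortestPath {m n} (N : Matrix m n) (i₁ i₂ : Fin m) {u : ℕ} {i : Fin m} (i∈R : Block.InR N i₁ i₂ i)
  (R-level : ∀ {i} → Block.InR N i₁ i₂ i → ∀ s → Block.RowWithin N i₁ i₂ s i → suc u ≤ s)
  (P : Block.Path N i₁ i₂ (suc u) i) where

  open Block N i₁ i₂
  open Path P

  private
    t : ℕ
    t = suc u

    last : Fin (suc t)
    last = fromℕ t

    w v : ℚ
    w = N (f zero) (g zero)
    v = N (f zero) (g last)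

    -- The minors of the path matrix at the first and last entries of its first row. Their diagonals
    -- consist of the path edges `edge (suc a)` and `edge′ a` respectively.
    Lower Upper : Matrix t t
    Lower a b = N (f (suc a)) (g (suc b))
    Upper a b = N (f (suc a)) (g (inject₁ b))

  f₀∈R : InR (f zero)
  f₀∈R = subst InR (sym f-start) i∈R

  toℕ≤t : ∀ (a : Fin (suc t)) → toℕ a ≤ t
  toℕ≤t a = ℕ.s≤s⁻¹ (Fin.toℕ<n a)

  level⇒zero : ∀ {a} → t ≤ t ∸ toℕ a → a ≡ zero
  level⇒zero {a} t≤ = Fin.toℕ-injective (ℕ.n≤0⇒n≡0 (ℕ.∸-cancelʳ-≤ {n = 0} (toℕ≤t a) t≤))

  level⇒last : ∀ {a} → t ∸ toℕ a ≤ 0 → a ≡ last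
  level⇒last {a} ≤0 = Fin.toℕ-injective (trans
    (ℕ.≤-antisym (toℕ≤t a) (ℕ.m∸n≡0⇒m≤n (ℕ.n≤0⇒n≡0 ≤0))) (sym (Fin.toℕ-fromℕ t)))

  -- Rows of R have level at least `t`, which the path attains only at its start.
  f∈R⇒zero : ∀ a → InR (f a) → a ≡ zero
  f∈R⇒zero a fa∈R = level⇒zero (R-level fa∈R _ (proj₁ (f-level a)))

  g∈C⇒last : ∀ b → InC (g b) → b ≡ last
  g∈C⇒last b gb∈C = level⇒last (proj₂ (g-level b) 0 gb∈C)

  g-last∈C : InC (g last)
  g-last∈C = subst (λ s → ColWithin s (g last))
    (trans (cong (t ∸_) (Fin.toℕ-fromℕ t)) (ℕ.n∸n≡0 t)) (proj₁ (g-level last))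

  level-injective : ∀ {a b : Fin (suc t)} → t ∸ toℕ a ≤ t ∸ toℕ b → t ∸ toℕ b ≤ t ∸ toℕ a → a ≡ b
  level-injective {a} {b} a≤b b≤a = Fin.toℕ-injective
    (ℕ.∸-cancelˡ-≡ (toℕ≤t a) (toℕ≤t b) (ℕ.≤-antisym a≤b b≤a))

  -- Equal vertices have equal distances to C, and the levels along the path are distinct.
  f-injective : Injective _≡_ _≡_ f
  f-injective {a} {b} fa≡fb = level-injective {a} {b}
    (proj₂ (f-level a) _ (subst (RowWithin _) (sym fa≡fb) (proj₁ (f-level b))))
    (proj₂ (f-level b) _ (subst (RowWithin _) fa≡fb (proj₁ (f-level a))))

  g-injective : Injective _≡_ _≡_ g
  g-injective {a} {b} ga≡gb = level-injective {a} {b}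
    (proj₂ (g-level a) _ (subst (ColWithin _) (sym ga≡gb) (proj₁ (g-level b))))
    (proj₂ (g-level b) _ (subst (ColWithin _) ga≡gb (proj₁ (g-level a))))

  ∸-suc-cancel : ∀ a b → a ≤ t → t ∸ b ≤ suc (t ∸ a) → a ≤ suc b
  ∸-suc-cancel zero    b _         _ = z≤n
  ∸-suc-cancel (suc a) b (s≤s a≤u) t∸b≤ = s≤s (ℕ.∸-cancelʳ-≤ (ℕ.m≤n⇒m≤1+n a≤u)
    (ℕ.≤-trans t∸b≤ (ℕ.≤-reflexive (sym (ℕ.+-∸-assoc 1 a≤u)))))

  -- Off the corner a nonzero entry is an edge, because the path meets R only at its start and C
  -- only at its end. Comparing levels then confines it to b ≤ a ≤ b + 1.
  chordless : ∀ a b → ¬ (a ≡ zero × b ≡ last) → ¬ (toℕ b ≤ toℕ a × toℕ a ≤ suc (toℕ b)) →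
    N (f a) (g b) ≡ 0ℚ
  chordless a b ¬corner ¬band = decidable-stable (N (f a) (g b) ≟ 0ℚ) λ N≢0 →
    let e : Edge (f a) (g b)
        e = N≢0 , λ { (fa∈R , gb∈C) → ¬corner (f∈R⇒zero a fa∈R , g∈C⇒last b gb∈C) }
        lo , hi = edge-levels (f-level a) (g-level b) e
    in ¬band (ℕ.∸-cancelʳ-≤ (toℕ≤t b) lo , ∸-suc-cancel (toℕ a) (toℕ b) (toℕ≤t a) hi)

  firstRow≡0 : ∀ b → suc b ≢ last → N (f zero) (g (suc b)) ≡ 0ℚ
  firstRow≡0 b b≢last = chordless zero (suc b) (b≢last ∘ proj₂) (λ { (() , _) })

  module _ (tu : TU N) where

    Lower-sign : IsSign (det Lower)
    Lower-sign = det-lowerTriangular Lower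
      (λ a b a<b → chordless (suc a) (suc b) (λ { (() , _) }) λ { (b≤a , _) → ℕ.<⇒≱ a<b (ℕ.s≤s⁻¹ b≤a) })
      (λ a → TU-entry N tu _ _ (proj₁ (edge (suc a))))

    Upper-sign : IsSign (det Upper)
    Upper-sign = det-upperTriangular Upper
      (λ a b b<a → chordless (suc a) (inject₁ b) (λ { (() , _) })
        λ { (_ , a≤b) → ℕ.<⇒≱ b<a (ℕ.≤-trans (ℕ.s≤s⁻¹ a≤b) (ℕ.≤-reflexive (Fin.toℕ-inject₁ b))) })
      (λ a → TU-entry N tu _ _ (proj₁ (edge′ a)))

    cycle-det : det (λ a b → N (f a) (g b)) ≡ w * det Lower + altSign t * (v * det Upper)
    cycle-det = det-firstRow₂ (λ a b → N (f a) (g b)) firstRow≡0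

    module _ {r : Fin m} (r∈R : InR r) (Nrg₀≡0 : N r (g zero) ≡ 0ℚ)
             {c : Fin n} (c∈C : InC c) (Nfc≡0 : N (f last) c ≡ 0ℚ) where

      private
        x y z : ℚ
        x = N r c
        y = N r (g last)
        z = N (f zero) c

        Z : Matrix m n
        Z = zeroEntry N (f zero) (g last)

        -- The path matrix with its corner zeroed, bordered by row `r` and column `c` in first
        -- position.
        Big : Matrix (suc (suc t)) (suc (suc t))
        Big a b = Z (cons r f a) (cons c g b)

      r≢f : ∀ a → r ≢ f a
      r≢f a r≡fa with refl ← f∈R⇒zero a (subst InR r≡fa r∈R) =
        proj₁ (edge zero) (subst (λ r → N r (g zero) ≡ 0ℚ) r≡fa Nrg₀≡0)

      c≢g : ∀ b → c ≢ g b
      c≢g b c≡gb with refl ← g∈C⇒last b (subst InC c≡gb c∈C) =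
        proj₁ (edge last) (subst (λ c → N (f last) c ≡ 0ℚ) c≡gb Nfc≡0)

      -- A nonzero entry would be an edge giving `r` at most the level of `g b`. As `r` lies in R,
      -- this forces `b ≡ zero`, where the entry is zero by the choice of `r`.
      row-r≡0 : ∀ b → b ≢ last → N r (g b) ≡ 0ℚ
      row-r≡0 b b≢last = decidable-stable (N r (g b) ≟ 0ℚ) λ N≢0 →
        let e : Edge r (g b)
            e = N≢0 , λ { (_ , gb∈C) → b≢last (g∈C⇒last b gb∈C) }
            b≡0 = level⇒zero (R-level r∈R _ (g b , proj₁ (g-level b) , e))
        in N≢0 (subst (λ b → N r (g b) ≡ 0ℚ) (sym b≡0) Nrg₀≡0)

      -- A nonzero entry would be an edge into C, so its row has level 0 and is the last one, where
      -- the entry is zero by the choice of `c`.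
      column-c≡0 : ∀ a → N (f (suc a)) c ≡ 0ℚ
      column-c≡0 a = decidable-stable (N (f (suc a)) c ≟ 0ℚ) λ N≢0 →
        let e : Edge (f (suc a)) c
            e = N≢0 , λ { (fa∈R , _) → Fin.0≢1+n (sym (f∈R⇒zero (suc a) fa∈R)) }
            a≡last = level⇒last (proj₂ (f-level (suc a)) 0 (c , c∈C , e))
        in N≢0 (subst (λ a → N (f a) c ≡ 0ℚ) (sym a≡last) Nfc≡0)

      Z-row-r : ∀ j → Z r j ≡ N r j
      Z-row-r j = zeroEntry-row N (g last) j (r≢f zero ∘ sym)

      Z-column-c : ∀ i → Z i c ≡ N i c
      Z-column-c i = zeroEntry-column N (f zero) i (c≢g last ∘ sym)

      Z-row : ∀ a j → Z (f (suc a)) j ≡ N (f (suc a)) j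
      Z-row a j = zeroEntry-row N (g last) j (Fin.0≢1+n ∘ f-injective)

      Z-column : ∀ i b → b ≢ last → Z i (g b) ≡ N i (g b)
      Z-column i b b≢last = zeroEntry-column N (f zero) i (b≢last ∘ sym ∘ g-injective)

      Z-firstRow≡0 : ∀ b → Z (f zero) (g (suc b)) ≡ 0ℚ
      Z-firstRow≡0 b with suc b Fin.≟ last
      ... | yes b≡last = subst (λ b → Z (f zero) (g b) ≡ 0ℚ) (sym b≡last) (zeroEntry-≡ N (f zero) (g last))
      ... | no b≢last  = trans (Z-column (f zero) (suc b) b≢last) (firstRow≡0 b b≢last)

      minor₀-det : det (minor Big zero) ≡ w * det Lower
      minor₀-det = trans (det-firstRow (minor Big zero) Z-firstRow≡0)
        (cong₂ _*_ (Z-column (f zero) zero λ ()) (det-cong λ a b → Z-row a (g (suc b))))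

      minorₗ-det : det (λ a b → Big (suc a) (inject₁ b)) ≡ z * det Upper
      minorₗ-det = trans
        (det-firstColumn (λ a b → Big (suc a) (inject₁ b)) (λ a → trans (Z-column-c (f (suc a))) (column-c≡0 a)))
        (cong₂ _*_ (Z-column-c (f zero)) (det-cong λ a b → Z-row a (g (inject₁ b))))

      -- Row `r` is nonzero only at `c` and `g last`. The last index is `suc t` instead of `t`,
      -- which reverses the sign of the second term relative to `cycle-det`.
      Big-det : det Big ≡ x * (w * det Lower) + - (x * (altSign t * (v * det Upper)))
      Big-det = begin
        det Big
          ≡⟨ det-firstRow₂ Big (λ b b≢last → trans (Z-row-r (g b)) (row-r≡0 b (b≢last ∘ cong suc))) ⟩
        Z r c * det (minor Big zero) + altSign (suc t) * (Z r (g last) * det (λ a b → Big (suc a) (inject₁ b)))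
          ≡⟨ cong₂ (λ p q → p + altSign (suc t) * q)
               (cong₂ _*_ (Z-row-r c) minor₀-det) (cong₂ _*_ (Z-row-r (g last)) minorₗ-det) ⟩
        x * (w * det Lower) + - altSign t * (y * (z * det Upper))
          ≡⟨ solve 5 (λ X s y z d → X :+ (:- s) :* (y :* (z :* d)) := X :+ (:- (s :* ((y :* z) :* d))))
               refl (x * (w * det Lower)) (altSign t) y z (det Upper) ⟩
        x * (w * det Lower) + - (altSign t * (y * z * det Upper))
          -- The block has rank one, so `y * z` equals `x * v` and the factor `x` can be taken out
          -- of both terms.
          ≡⟨ cong (λ q → x * (w * det Lower) + - (altSign t * (q * det Upper)))
               (TU-2×2 N tu {r} {f zero} {c} {g last} (r∈R c c∈C) (r∈R _ g-last∈C) (f₀∈R c c∈C) (f₀∈R _ g-last∈C)) ⟨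
        x * (w * det Lower) + - (altSign t * (x * v * det Upper))
          ≡⟨ solve 5 (λ X s x v d → X :+ (:- (s :* ((x :* v) :* d))) := X :+ (:- (x :* (s :* (v :* d)))))
               refl (x * (w * det Lower)) (altSign t) x v (det Upper) ⟩
        x * (w * det Lower) + - (x * (altSign t * (v * det Upper))) ∎

      zeroed-not-TU : ¬ TU Z
      zeroed-not-TU tuZ = ¬unimodular-both
        (TU-entry N tu r c (r∈R c c∈C))
        (sign-* (TU-entry N tu _ _ (proj₁ (edge zero))) Lower-sign)
        (sign-* (altSign-sign t) (sign-* (TU-entry N tu _ _ (f₀∈R _ g-last∈C)) Upper-sign))
        (subst Unimodular cycle-det (tu (suc t) f g f-injective g-injective))
        (subst Unimodular Big-det (tuZ (suc (suc t)) (cons r f) (cons c g)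
          (cons-injective r≢f f-injective) (cons-injective c≢g g-injective)))

  -- As `t` is positive, `f last` is outside R and `g zero` outside C. The former supplies `c`; by
  -- the latter, `i₁` or `i₂`, both in R, is zero at `g zero` and serves as `r`.
  not-SU : ¬ SU N
  not-SU (tu , su) = refute (N i₁ (g zero) ≟ 0ℚ) (N i₂ (g zero) ≟ 0ℚ)
    where
    last∉R : ¬ InR (f last)
    last∉R fl∈R = Fin.0≢1+n (sym (f∈R⇒zero last fl∈R))

    missing : ∃ λ c → ¬ (InC c → N (f last) c ≢ 0ℚ)
    missing = Fin.¬∀⟶∃¬ n _ (λ j → InC? j →-dec N≢0? (f last) j) last∉R

    c : Fin n
    c = proj₁ missing

    c∈C : InC c
    c∈C = decidable-stable (InC? c) λ c∉C → proj₂ missing λ c∈C → contradiction c∈C c∉C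

    Nfc≡0 : N (f last) c ≡ 0ℚ
    Nfc≡0 = decidable-stable (N (f last) c ≟ 0ℚ) λ N≢0 → proj₂ missing λ _ → N≢0

    with-row : ∀ {r} → InR r → ¬ (N r (g zero) ≡ 0ℚ)
    with-row r∈R ≡0 = zeroed-not-TU tu r∈R ≡0 c∈C Nfc≡0
      (su (f zero) (g last) (TU-entry N tu _ _ (f₀∈R _ g-last∈C)))

    refute : Dec (N i₁ (g zero) ≡ 0ℚ) → ¬ Dec (N i₂ (g zero) ≡ 0ℚ)
    refute (yes ≡0) _         = with-row (λ _ → proj₁) ≡0
    refute (no _)   (yes ≡0)  = with-row (λ _ → proj₂) ≡0
    refute (no ≢0)  (no ≢0′)  = Fin.0≢1+n (g∈C⇒last zero (≢0 , ≢0′))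

-- The dichotomy between a separation and a shortest path.

scaled≡1⇒≢0 : ∀ r {q} c → r * q * c ≡ 1ℚ → q ≢ 0ℚ
scaled≡1⇒≢0 r c eq refl = ℚ.1≢0 (trans (sym eq) (*-zeroˡ′ c (ℚ.*-zeroʳ r)))

theorem6 : (m n : ℕ) → m ≥ 3 → n ≥ 3 → (N : Matrix m n) →
    Regular (matroidOf N) → ThreeConnected (matroidOf N) →
    ContainsAllOnes2 N → ¬ SU N
theorem6 m n _ _ N _ connected
  (i₁ , i₂ , j₁ , j₂ , i₁≢i₂ , j₁≢j₂ , r₁ , r₂ , c₁ , c₂ , _ , _ , _ , _ , e₁₁ , e₁₂ , e₂₁ , e₂₂) su =
  conclude (stabilises ColWithin ColWithin? (λ _ _ → inj₁))
  where
  open Block N i₁ i₂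

  j₁∈C : InC j₁
  j₁∈C = scaled≡1⇒≢0 r₁ c₁ e₁₁ , scaled≡1⇒≢0 r₂ c₁ e₂₁

  j₂∈C : InC j₂
  j₂∈C = scaled≡1⇒≢0 r₁ c₂ e₁₂ , scaled≡1⇒≢0 r₂ c₂ e₂₂

  Reached : ℕ → Set
  Reached t = ∃ λ i → InR i × RowWithin t i

  Reached? : ∀ t → Dec (Reached t)
  Reached? t = Fin.any? (λ i → InR? i ×-dec RowWithin? t i)

  minimal-not-SU : ¬ (∃ λ t → Reached t × (∀ s → Reached s → t ≤ s))
  -- An edge from R directly into C would lie in the block.
  minimal-not-SU (zero , (i , i∈R , j , j∈C , _ , outside-block) , _) = outside-block (i∈R , j∈C)
  minimal-not-SU (suc u , (i , i∈R , row) , min) =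
    ShortestPath.not-SU N i₁ i₂ i∈R R-level (path (suc u) i (row , R-level i∈R)) su
    where
    R-level : ∀ {i} → InR i → ∀ s → RowWithin s i → suc u ≤ s
    R-level i∈R s row = min s (_ , i∈R , row)

  conclude : ¬ (∃ λ t → ∀ j → ColWithin (suc t) j → ColWithin t j)
  -- The columns reached at a stable stage are closed under paths, so `Reached? t` decides whether
  -- any path joins R to C.
  conclude (t , stable) with Reached? t
  ... | yes reached = minimal-not-SU (least Reached Reached? t reached)
  ... | no ¬reached = connected 2 (s≤s z≤n) (s≤s (s≤s (s≤s z≤n)))
    (unreachable⇒separation (proj₁ su) i₁≢i₂ j₁≢j₂ j₁∈C j₂∈C t stable (λ i i∈R row → ¬reached (i , i∈R , row)))
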